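{- Let $t\neq 0$. For every integer $n\ge 0$, $$\sum_{k=0}^n \frac{(-1)^k}{2 t^k} \left(Q_{k+1} +2(t-1)P_{k}\right) = \frac{(-1)^n}{t^n}P_{n+1},$$ where $P_k$ and $Q_k$ are the $k$th Pell and Pell-Lucas numbers.
   Context: The Pell numbers $P_k$ and Pell-Lucas numbers $Q_k$ ($k\ge 0$) both satisfy $x_{n+2}=2x_{n+1}+x_n$ for $n\ge 0$, with initial values $P_0=0$, $P_1=1$ and $Q_0=Q_1=2$. Here $t$ is an indeterminate, which may be specialized to any nonzero complex number. -}

module Defs where

open import Algebra.Apartness.Bundles using (HeytingField)
open import Data.Nat.Base as ℕ using (ℕ; zero; suc)
open import Data.Product.Base using (proj₁)

P : ℕ → ℕ
P 0             = 0
P 1             = 1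
P (suc (suc n)) = 2 ℕ.* P (suc n) ℕ.+ P n

Q : ℕ → ℕ
Q 0             = 2
Q 1             = 2
Q (suc (suc n)) = 2 ℕ.* Q (suc n) ℕ.+ Q n

module FieldNotation {c ℓ₁ ℓ₂} (K : HeytingField c ℓ₁ ℓ₂) where

  open HeytingField K public
    using (Carrier; _≈_; _#_; _+_; _-_; _*_; -_; 0#; 1#)
  open HeytingField K using (heytingCommutativeRing; #⇒invertible)

  open import Algebra.Apartness.Bundles using (HeytingCommutativeRing)
  open import Algebra.Bundles using (CommutativeRing)
  open import Algebra.Apartness.Properties.HeytingCommutativeRing heytingCommutativeRing
    using (1#0; x#0y#0→xy#0)

  open CommutativeRing (HeytingCommutativeRing.commutativeRing heytingCommutativeRing)
    using (semiring; +-monoid)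
  open import Algebra.Properties.Semiring.Exp semiring public
    using (_^_)
  open import Algebra.Properties.Semiring.Mult semiring public
    using (_×_)
  open import Algebra.Properties.Monoid.Sum +-monoid public
    using (sum⁺-syntax)

  -- The canonical image of a natural number in K.
  fromℕ : ℕ → Carrier
  fromℕ n = n × 1#

  infix 9 _⁻¹⟨_⟩

  -- The library derives from  x # 0#  an inverse of  x - 0# , which is
  -- then also an inverse of  x .
  _⁻¹⟨_⟩ : (x : Carrier) → x # 0# → Carrier
  x ⁻¹⟨ x#0 ⟩ = proj₁ (#⇒invertible x#0)

  infixl 7 _/_⟨_⟩

  _/_⟨_⟩ : (x y : Carrier) → y # 0# → Carrier
  x / y ⟨ y#0 ⟩ = x * y ⁻¹⟨ y#0 ⟩

  *-#0 : ∀ {x y} → x # 0# → y # 0# → x * y # 0#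
  *-#0 = x#0y#0→xy#0

  ^-#0 : ∀ {x} → x # 0# → ∀ k → x ^ k # 0#
  ^-#0 x#0 zero    = 1#0
  ^-#0 x#0 (suc k) = *-#0 x#0 (^-#0 x#0 k)

{-# OPTIONS --safe #-}

-- Since Q (k + 1) = 2 (P (k + 1) + P k), the k-th summand equals
-- a k − a (k − 1) with a k = (-1)ᵏ P (k + 1) / tᵏ, so the sum telescopes.

module Submission where

open import Defs
open import Algebra.Apartness.Bundles using (HeytingField)
open import Data.Nat.Base using (ℕ; suc)
open import Data.Fin.Base using (toℕ)

open import Algebra.Apartness.Bundles using (HeytingCommutativeRing)
open import Algebra.Bundles using (CommutativeRing)
open import Data.Nat.Base as ℕ using (zero)
open import Data.Nat.Tactic.RingSolver using (solve-∀)
open import Data.Product.Base using (proj₁; proj₂)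
open import Relation.Binary.PropositionalEquality.Core as ≡ using (_≡_)

-- Substituting for `Q (suc k)`, the two multiples of P_k in the bracket merge and leave 2 (P_{k+1}
-- + t P_k); the 2 cancels against the denominator. Of the resulting (-1)^k (P_{k+1} + t P_k) / t^k,
-- the first part is `partial k`, and the second, after cancelling one t, is minus its predecessor
-- when k > 0. At k = 0 it vanishes because P_0 = 0, so the sum collapses to `partial n`.

Q[1+k]≡2[P[1+k]+Pk] : ∀ k → Q (suc k) ≡ 2 ℕ.* (P (suc k) ℕ.+ P k)
Q[1+k]≡2[P[1+k]+Pk] 0             = ≡.refl
Q[1+k]≡2[P[1+k]+Pk] 1             = ≡.refl
-- Both sides obey the Pell recurrence, so agreement at two consecutive indices propagates.
Q[1+k]≡2[P[1+k]+Pk] (suc (suc k)) = ≡.trans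
  (≡.cong₂ (λ x y → 2 ℕ.* x ℕ.+ y)
    (Q[1+k]≡2[P[1+k]+Pk] (suc k)) (Q[1+k]≡2[P[1+k]+Pk] k))
  (regroup (P (suc (suc k))) (P (suc k)) (P k))
  where
  regroup : ∀ x y z → 2 ℕ.* (2 ℕ.* (x ℕ.+ y)) ℕ.+ 2 ℕ.* (y ℕ.+ z)
                    ≡ 2 ℕ.* ((2 ℕ.* x ℕ.+ y) ℕ.+ (2 ℕ.* y ℕ.+ z))
  regroup = solve-∀

module _ {c ℓ₁ ℓ₂} (K : HeytingField c ℓ₁ ℓ₂) where

  open FieldNotation K
  open HeytingField K using (heytingCommutativeRing; #⇒invertible)
  open CommutativeRing (HeytingCommutativeRing.commutativeRing heytingCommutativeRing)
    hiding (Carrier; _≈_; _+_; _-_; _*_; -_; 0#; 1#; zero)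
  open import Algebra.Apartness.Properties.HeytingCommutativeRing heytingCommutativeRing
    using (x-0≈x)
  open import Algebra.Properties.Monoid.Sum +-monoid using (sum)
  open import Algebra.Properties.Semiring.Mult semiring using (×-congˡ; ×-homo-+; ×1-homo-*)
  open import Algebra.Solver.Ring.NaturalCoefficients.Default commutativeSemiring
    using (solve; _:=_; _:+_; _:*_; con)
  open import Relation.Binary.Reasoning.Setoid setoid

  -- The start `a 0` stays outside the sum, so no value at index -1 is needed. Sums unfold from the
  -- front, hence the induction absorbs `f 1` into `a 0` and shifts both sequences.
  sum-telescope : (a f : ℕ → Carrier) → (∀ k → a k + f (suc k) ≈ a (suc k)) →
                  ∀ n → a 0 + sum {n} (λ i → f (suc (toℕ i))) ≈ a n
  sum-telescope a f step zero    = +-identityʳ (a 0)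
  sum-telescope a f step (suc n) = begin
    a 0 + (f 1 + sum {n} (λ i → f (suc (suc (toℕ i)))))  ≈⟨ +-assoc _ _ _ ⟨
    a 0 + f 1 + sum {n} (λ i → f (suc (suc (toℕ i))))    ≈⟨ +-congʳ (step 0) ⟩
    a 1 + sum {n} (λ i → f (suc (suc (toℕ i))))
      ≈⟨ sum-telescope (λ k → a (suc k)) (λ k → f (suc k)) (λ k → step (suc k)) n ⟩
    a (suc n)                                            ∎

  ⁻¹-inverseˡ : ∀ {x} (x#0 : x # 0#) → x ⁻¹⟨ x#0 ⟩ * x ≈ 1#
  ⁻¹-inverseˡ {x} x#0 =
    trans (*-congˡ (sym (x-0≈x x))) (proj₁ (proj₂ (#⇒invertible x#0)))

  -- Multiply by y⁻¹ y = 1 and regroup. This serves both cancellations: of 2 in 2 t^k and of one t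
  -- in t^(k+1). The apartness proofs are arbitrary, so inverses built from unrelated witnesses can
  -- be compared.
  [xy]⁻¹x≈y⁻¹ : ∀ {x y} (xy#0 : x * y # 0#) (y#0 : y # 0#) →
                (x * y) ⁻¹⟨ xy#0 ⟩ * x ≈ y ⁻¹⟨ y#0 ⟩
  [xy]⁻¹x≈y⁻¹ {x} {y} xy#0 y#0 = begin
    i * x            ≈⟨ *-identityʳ _ ⟨
    i * x * 1#       ≈⟨ *-congˡ (⁻¹-inverseˡ y#0) ⟨
    i * x * (j * y)  ≈⟨ solve 4 (λ i x j y → i :* x :* (j :* y) := i :* (x :* y) :* j)
                          refl i x j y ⟩
    i * (x * y) * j  ≈⟨ *-congʳ (⁻¹-inverseˡ xy#0) ⟩
    1# * j           ≈⟨ *-identityˡ j ⟩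
    j                ∎
    where
    i = (x * y) ⁻¹⟨ xy#0 ⟩
    j = y ⁻¹⟨ y#0 ⟩

  fromℕ-Q : ∀ k → fromℕ (Q (suc k)) ≈ fromℕ 2 * (fromℕ (P (suc k)) + fromℕ (P k))
  fromℕ-Q k = begin
    fromℕ (Q (suc k))                              ≈⟨ ×-congˡ (Q[1+k]≡2[P[1+k]+Pk] k) ⟩
    fromℕ (2 ℕ.* (P (suc k) ℕ.+ P k))              ≈⟨ ×1-homo-* 2 (P (suc k) ℕ.+ P k) ⟩
    fromℕ 2 * fromℕ (P (suc k) ℕ.+ P k)            ≈⟨ *-congˡ (×-homo-+ 1# (P (suc k)) (P k)) ⟩
    fromℕ 2 * (fromℕ (P (suc k)) + fromℕ (P k))    ∎

  bracket-halved : ∀ t k →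
    fromℕ (Q (suc k)) + fromℕ 2 * (t - 1#) * fromℕ (P k)
    ≈ fromℕ 2 * (fromℕ (P (suc k)) + t * fromℕ (P k))
  bracket-halved t k = begin
    fromℕ (Q (suc k)) + two * (t - 1#) * p  ≈⟨ +-congʳ (fromℕ-Q k) ⟩
    two * (p′ + p) + two * (t - 1#) * p
      -- The solver works over semirings, so -1 enters as an atom `m`; the factor 1 + m is isolated
      -- and cancelled afterwards.
      ≈⟨ solve 5 (λ two t m p p′ → two :* (p′ :+ p) :+ two :* (t :+ m) :* p
                                := two :* (p′ :+ ((con 1 :+ m) :+ t) :* p))
           refl two t (- 1#) p p′ ⟩
    two * (p′ + ((1# - 1#) + t) * p)
      ≈⟨ *-congˡ (+-congˡ (*-congʳ (+-congʳ (-‿inverseʳ 1#)))) ⟩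
    two * (p′ + (0# + t) * p)               ≈⟨ *-congˡ (+-congˡ (*-congʳ (+-identityˡ t))) ⟩
    two * (p′ + t * p)                      ∎
    where
    two = fromℕ 2
    p   = fromℕ (P k)
    p′  = fromℕ (P (suc k))

  module _ (2#0 : fromℕ 2 # 0#) (t : Carrier) (t#0 : t # 0#) where

    partial : ℕ → Carrier
    partial k = ((- 1#) ^ k) / (t ^ k) ⟨ ^-#0 t#0 k ⟩ * fromℕ (P (suc k))

    summand : ℕ → Carrier
    summand k = ((- 1#) ^ k) / (fromℕ 2 * t ^ k) ⟨ *-#0 2#0 (^-#0 t#0 k) ⟩
                * (fromℕ (Q (suc k)) + fromℕ 2 * (t - 1#) * fromℕ (P k))

    summand-halved : ∀ k →
      summand k ≈ ((- 1#) ^ k) / (t ^ k) ⟨ ^-#0 t#0 k ⟩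
                  * (fromℕ (P (suc k)) + t * fromℕ (P k))
    summand-halved k = begin
      s * e * (fromℕ (Q (suc k)) + fromℕ 2 * (t - 1#) * fromℕ (P k))
        ≈⟨ *-congˡ (bracket-halved t k) ⟩
      s * e * (fromℕ 2 * b)
        ≈⟨ solve 4 (λ s e two b → s :* e :* (two :* b) := s :* (e :* two) :* b)
             refl s e (fromℕ 2) b ⟩
      s * (e * fromℕ 2) * b
        ≈⟨ *-congʳ (*-congˡ ([xy]⁻¹x≈y⁻¹ (*-#0 2#0 (^-#0 t#0 k)) (^-#0 t#0 k))) ⟩
      s * (t ^ k) ⁻¹⟨ ^-#0 t#0 k ⟩ * b  ∎
      where
      s = (- 1#) ^ k
      e = (fromℕ 2 * t ^ k) ⁻¹⟨ *-#0 2#0 (^-#0 t#0 k) ⟩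
      b = fromℕ (P (suc k)) + t * fromℕ (P k)

    -- The term t P_0 vanishes.
    summand-zero : summand 0 ≈ partial 0
    summand-zero =
      trans (summand-halved 0) (*-congˡ (trans (+-congˡ (zeroʳ t)) (+-identityʳ _)))

    partial-step : ∀ k → partial k + summand (suc k) ≈ partial (suc k)
    partial-step k = begin
      s * j * p + summand (suc k)                ≈⟨ +-congˡ (summand-halved (suc k)) ⟩
      s * j * p + m * s * i * (p′ + t * p)
        -- Writing 1 / t^k as t / t^(k+1) gives both terms a common denominator; the two multiples
        -- of `p` then differ only by the sign `m` and cancel.
        ≈⟨ +-congʳ (*-congʳ (*-congˡ ([xy]⁻¹x≈y⁻¹ (^-#0 t#0 (suc k)) (^-#0 t#0 k)))) ⟨
      s * (i * t) * p + m * s * i * (p′ + t * p)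
        ≈⟨ solve 6 (λ m s i t p p′ →
               s :* (i :* t) :* p :+ m :* s :* i :* (p′ :+ t :* p)
            := (con 1 :+ m) :* (s :* (i :* t) :* p) :+ m :* s :* i :* p′)
             refl m s i t p p′ ⟩
      (1# - 1#) * (s * (i * t) * p) + m * s * i * p′
        ≈⟨ +-congʳ (*-congʳ (-‿inverseʳ 1#)) ⟩
      0# * (s * (i * t) * p) + m * s * i * p′    ≈⟨ +-congʳ (zeroˡ _) ⟩
      0# + m * s * i * p′                        ≈⟨ +-identityˡ _ ⟩
      m * s * i * p′                             ∎
      where
      m  = - 1#
      s  = (- 1#) ^ k
      i  = (t ^ suc k) ⁻¹⟨ ^-#0 t#0 (suc k) ⟩
      j  = (t ^ k) ⁻¹⟨ ^-#0 t#0 k ⟩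
      p  = fromℕ (P (suc k))
      p′ = fromℕ (P (suc (suc k)))

mainTheorem5 : ∀ {c ℓ₁ ℓ₂} (K : HeytingField c ℓ₁ ℓ₂) → let open FieldNotation K in
    (2#0 : fromℕ 2 # 0#) (t : Carrier) (t#0 : t # 0#) (n : ℕ) →
    (∑[ i ≤ n ]
    ( ((- 1#) ^ toℕ i) / (fromℕ 2 * t ^ toℕ i) ⟨ *-#0 2#0 (^-#0 t#0 (toℕ i)) ⟩
    * (fromℕ (Q (suc (toℕ i))) + fromℕ 2 * (t - 1#) * fromℕ (P (toℕ i))) ))
    ≈ ((- 1#) ^ n) / (t ^ n) ⟨ ^-#0 t#0 n ⟩ * fromℕ (P (suc n))
mainTheorem5 K 2#0 t t#0 n = trans
  -- The sum over i ≤ n has n + 1 terms and unfolds to `summand 0` plus the n terms that telescope.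
  (+-congʳ (summand-zero K 2#0 t t#0))
  (sum-telescope K (partial K 2#0 t t#0) (summand K 2#0 t t#0) (partial-step K 2#0 t t#0) n)
  where open HeytingField K using (trans; +-congʳ)
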